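{- Let $n_1\ge n_2\ge n_3\ge 1$ be integers. Then $\mathrm{ar}(K_{n_1,n_2,n_3}, C_4^{\text{multi}})=n_1n_2+n_3+1$.
   Context: $K_{n_1,n_2,n_3}$ denotes the complete $3$-partite graph with parts $V_1,V_2,V_3$ of sizes $n_1,n_2,n_3$. $C_4^{\text{multi}}$ denotes a multipartite $4$-cycle, i.e. a cycle of length $4$ containing at least one vertex in each of the three parts. A subgraph of an edge-colored graph is rainbow if all its edges have distinct colors. The anti-Ramsey number $\mathrm{ar}(K_{n_1,n_2,n_3}, C_4^{\text{multi}})$ is the maximum number of colors in an edge-coloring of $K_{n_1,n_2,n_3}$ with no rainbow $C_4^{\text{multi}}$. -}

module Defs where

open import Data.Nat using (ℕ; _+_; _*_; _≤_; _≥_)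
open import Data.Fin using (Fin; zero; suc)
open import Data.Empty using (⊥)
open import Data.Sum using (_⊎_; inj₁; inj₂)
open import Data.Product using (Σ; ∃; _×_; _,_)
open import Relation.Binary.PropositionalEquality using (_≡_; _≢_)

Vertex : ℕ → ℕ → ℕ → Set
Vertex n₁ n₂ n₃ = Fin n₁ ⊎ (Fin n₂ ⊎ Fin n₃)

part : ∀ {n₁ n₂ n₃} → Vertex n₁ n₂ n₃ → Fin 3
part (inj₁ _)        = zero
part (inj₂ (inj₁ _)) = suc zero
part (inj₂ (inj₂ _)) = suc (suc zero)

Adj : ∀ {n₁ n₂ n₃} → Vertex n₁ n₂ n₃ → Vertex n₁ n₂ n₃ → Set
Adj u v = part u ≢ part v

-- An edge-colouring of K_{n1,n2,n3} with exactly k colours: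
-- a symmetric colour function on vertex pairs (values on non-edges are
-- irrelevant) such that every colour in Fin k is used on some edge.
record Colouring (n₁ n₂ n₃ k : ℕ) : Set where
  field
    col  : Vertex n₁ n₂ n₃ → Vertex n₁ n₂ n₃ → Fin k
    symm : ∀ u v → col u v ≡ col v u
    onto : ∀ (x : Fin k) → Σ (Vertex n₁ n₂ n₃) λ u → Σ (Vertex n₁ n₂ n₃) λ v →
             Adj u v × col u v ≡ x
open Colouring public

record MultiC4 {n₁ n₂ n₃ : ℕ} (a b c d : Vertex n₁ n₂ n₃) : Set where
  field
    a≢b : a ≢ b
    a≢c : a ≢ c
    a≢d : a ≢ d
    b≢c : b ≢ c
    b≢d : b ≢ d
    c≢d : c ≢ d
    ab : Adj a b
    bc : Adj b c
    cd : Adj c d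
    da : Adj d a
    allParts : ∀ (i : Fin 3) → (part a ≡ i) ⊎ (part b ≡ i) ⊎ (part c ≡ i) ⊎ (part d ≡ i)

Rainbow : ∀ {n₁ n₂ n₃ k} → Colouring n₁ n₂ n₃ k →
          (a b c d : Vertex n₁ n₂ n₃) → Set
Rainbow C a b c d =
  let e₁ = col C a b ; e₂ = col C b c ; e₃ = col C c d ; e₄ = col C d a in
  e₁ ≢ e₂ × e₁ ≢ e₃ × e₁ ≢ e₄ × e₂ ≢ e₃ × e₂ ≢ e₄ × e₃ ≢ e₄

NoRainbowMultiC4 : ∀ {n₁ n₂ n₃ k} → Colouring n₁ n₂ n₃ k → Set
NoRainbowMultiC4 {n₁} {n₂} {n₃} C =
  ∀ (a b c d : Vertex n₁ n₂ n₃) → MultiC4 a b c d → Rainbow C a b c d → ⊥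

IsAntiRamseyC4multi : ℕ → ℕ → ℕ → ℕ → Set
IsAntiRamseyC4multi n₁ n₂ n₃ m =
  (Σ (Colouring n₁ n₂ n₃ m) NoRainbowMultiC4) ×
  (∀ k (C : Colouring n₁ n₂ n₃ k) → NoRainbowMultiC4 C → k ≤ m)

{-# OPTIONS --safe #-}
module Submission where

-- Lower bound: give the edges between V₁ and V₂ distinct colours, give all edges
-- from V₁ to a vertex of V₃ one colour of its own, and all edges between V₂ and
-- V₃ one further colour.
--
-- Upper bound, by induction on the number of vertices.  A colour at a vertex v is
-- lost if it is missing from a list L that contains all colours of the colouring
-- without v; it then occurs only at v.  Let v have two distinct lost colours on
-- vx and vy.  Every multipartite 4-cycle v x w y forces wx and wy to have the same
-- colour.  If x and y lie in one part they are therefore twins with respect to the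
-- third part, so deleting x only loses colours towards the part of v; otherwise x
-- and y agree on the part of v, outside v.  The bound then follows by deleting a
-- suitable vertex.  Only when all parts have the same size is deleting one vertex
-- too expensive, and a pair of vertices of different parts is deleted instead.

open import Defs
open import Data.Nat using (ℕ; zero; suc; _+_; _*_; _≤_; _≥_; z≤n; s≤s)
open import Data.Nat.Properties using (n<1+n; ≤-trans; ≤-refl; ≤-reflexive; +-mono-≤; +-monoˡ-≤;
  m≤n+m; n≤1+n; ≤-pred; m≤n⇒m<n∨m≡n)
open import Data.Fin using (Fin; zero; suc; _↑ˡ_; _↑ʳ_; combine; remQuot; splitAt; join;
  punchIn; punchOut; _≟_)
open import Data.Fin.Properties using (join-splitAt; combine-remQuot; injective⇒≤; any?; <⇒≢;
  punchIn-punchOut; punchInᵢ≢i; punchOut-injective; pigeonhole)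
open import Data.Product using (Σ; ∃; ∃₂; _×_; _,_; proj₁; proj₂)
open import Data.Sum using (_⊎_; inj₁; inj₂)
open import Data.Empty using (⊥; ⊥-elim)
open import Data.Unit using (tt)
open import Data.List using (List; []; _∷_; _++_; length; lookup; tabulate)
open import Data.List.Properties using (length-++; length-tabulate)
open import Data.List.Relation.Unary.Any using (here; there)
open import Data.List.Relation.Unary.Any.Properties using (lookup-index)
open import Data.List.Membership.Propositional using (_∈_; _∉_)
open import Data.List.Membership.Propositional.Properties using (∈-++⁺ˡ; ∈-++⁺ʳ; ∈-tabulate⁺)
open import Data.List.Membership.DecPropositional using (_∈?_)
open import Function using (_∘_; flip; id)
open import Data.Nat.Tactic.RingSolver using (solve-∀)
open import Relation.Unary using (Pred; U)
open import Relation.Nullary using (¬_; yes; no; contradiction)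
open import Relation.Nullary.Decidable using (decidable-stable; ¬?)
open import Relation.Binary.PropositionalEquality using (_≡_; _≢_; refl; sym; trans; cong; subst)
open import Level using (0ℓ)

private variable
  K m m′ n n₁ n₂ n₃ t : ℕ

-- Rainbow-free 4-cycles between three parts

NonRainbow : (p q r s : Fin K) → Set
NonRainbow p q r s = p ≢ q → p ≢ r → p ≢ s → q ≢ r → q ≢ s → r ≢ s → ⊥

exchange : ∀ {p q r s : Fin K} → NonRainbow p q r s → NonRainbow r s p q
exchange N rs rp rq sp sq pq = N pq (rp ∘ sym) (sp ∘ sym) (rq ∘ sym) (sq ∘ sym) rs

transpose : ∀ {p q r s : Fin K} → NonRainbow p q r s → NonRainbow p r q s
transpose N pr pq ps rq rs qs = N pq pr ps (rq ∘ sym) qs rs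

separated : {L : List (Fin K)} {x y : Fin K} → x ∈ L → y ∉ L → x ≢ y
separated x∈L y∉L refl = y∉L x∈L

-- Distinct colours outside `L` also differ from all colours in `L`. Five of the six inequalities
-- therefore hold, and only `p ≡ q` can prevent a rainbow cycle.
forced : {L : List (Fin K)} {p q r s : Fin K} → NonRainbow p q r s →
  r ∉ L → s ∉ L → r ≢ s → p ∈ L → q ∈ L → p ≡ q
forced {p = p} {q} N r∉ s∉ r≢s p∈ q∈ = decidable-stable (p ≟ q) λ p≢q →
  N p≢q (separated p∈ r∉) (separated p∈ s∉) (separated q∈ r∉) (separated q∈ s∉) r≢s

-- The colours of the edges between the three parts, where a multipartite
-- 4-cycle is given by its two vertices in a common part and its two others.
record Tri (K n₁ n₂ n₃ : ℕ) : Set where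
  field
    e₁₂ : Fin n₁ → Fin n₂ → Fin K
    e₁₃ : Fin n₁ → Fin n₃ → Fin K
    e₂₃ : Fin n₂ → Fin n₃ → Fin K
    cycle₁ : ∀ i i′ j k → NonRainbow (e₁₂ i j) (e₁₂ i′ j) (e₁₃ i k) (e₁₃ i′ k)
    cycle₂ : ∀ j j′ i k → NonRainbow (e₁₂ i j) (e₁₂ i j′) (e₂₃ j k) (e₂₃ j′ k)
    cycle₃ : ∀ k k′ i j → NonRainbow (e₁₃ i k) (e₁₃ i k′) (e₂₃ j k) (e₂₃ j k′)
open Tri

swap₁₂ : Tri K n₁ n₂ n₃ → Tri K n₂ n₁ n₃
swap₁₂ T = record
  { e₁₂ = flip (e₁₂ T) ; e₁₃ = e₂₃ T ; e₂₃ = e₁₃ T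
  ; cycle₁ = cycle₂ T ; cycle₂ = cycle₁ T
  ; cycle₃ = λ k k′ j i → exchange (cycle₃ T k k′ i j) }

swap₂₃ : Tri K n₁ n₂ n₃ → Tri K n₁ n₃ n₂
swap₂₃ T = record
  { e₁₂ = e₁₃ T ; e₁₃ = e₁₂ T ; e₂₃ = flip (e₂₃ T)
  ; cycle₁ = λ i i′ k j → exchange (cycle₁ T i i′ j k)
  ; cycle₂ = cycle₃ T ; cycle₃ = cycle₂ T }

restrict : (Fin m → Fin n₁) → (Fin m′ → Fin n₂) → (Fin n → Fin n₃) →
  Tri K n₁ n₂ n₃ → Tri K m m′ n
restrict α β γ T = record
  { e₁₂ = λ i j → e₁₂ T (α i) (β j)
  ; e₁₃ = λ i k → e₁₃ T (α i) (γ k)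
  ; e₂₃ = λ j k → e₂₃ T (β j) (γ k)
  ; cycle₁ = λ i i′ j k → cycle₁ T (α i) (α i′) (β j) (γ k)
  ; cycle₂ = λ j j′ i k → cycle₂ T (β j) (β j′) (α i) (γ k)
  ; cycle₃ = λ k k′ i j → cycle₃ T (γ k) (γ k′) (α i) (β j) }

-- Colour lists, deletion and reinsertion of vertices

record Covers (T : Tri K n₁ n₂ n₃) (P : Pred (Fin n₁) 0ℓ) (Q : Pred (Fin n₂) 0ℓ)
              (R : Pred (Fin n₃) 0ℓ) (L : List (Fin K)) : Set where
  field
    ∈₁₂ : ∀ {i j} → P i → Q j → e₁₂ T i j ∈ L
    ∈₁₃ : ∀ {i k} → P i → R k → e₁₃ T i k ∈ L
    ∈₂₃ : ∀ {j k} → Q j → R k → e₂₃ T j k ∈ L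
open Covers

-- Deleting vertices may make colours disappear, so the palette `Fin K` stays fixed and colours are
-- counted through a list containing them all.
Cover : Tri K n₁ n₂ n₃ → ℕ → Set
Cover T m = ∃ λ L → length L ≤ m × Covers T U U U L

Bound : (K n₁ n₂ n₃ m : ℕ) → Set
Bound K n₁ n₂ n₃ m = (T : Tri K n₁ n₂ n₃) → Cover T m

unswap₁₂ : {T : Tri K n₁ n₂ n₃} → Cover (swap₁₂ T) m → Cover T m
unswap₁₂ (L , len , cov) = L , len , record
  { ∈₁₂ = λ p q → ∈₁₂ cov q p ; ∈₁₃ = ∈₂₃ cov ; ∈₂₃ = ∈₁₃ cov }

unswap₂₃ : {T : Tri K n₁ n₂ n₃} → Cover (swap₂₃ T) m → Cover T m
unswap₂₃ (L , len , cov) = L , len , record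
  { ∈₁₂ = ∈₁₃ cov ; ∈₁₃ = ∈₁₂ cov ; ∈₂₃ = λ q r → ∈₂₃ cov r q }

bound₁₂ : Bound K n₁ n₂ n₃ m → Bound K n₂ n₁ n₃ m
bound₁₂ B T = unswap₁₂ (B (swap₁₂ T))

bound₂₃ : Bound K n₁ n₂ n₃ m → Bound K n₁ n₃ n₂ m
bound₂₃ B T = unswap₂₃ (B (swap₂₃ T))

avoids : {a i : Fin (suc n)} → i ≢ a → ∃ λ i′ → punchIn a i′ ≡ i
avoids i≢a = punchOut (i≢a ∘ sym) , punchIn-punchOut (i≢a ∘ sym)

delete₁ : Bound K n₁ n₂ n₃ m → (T : Tri K (suc n₁) n₂ n₃) (a : Fin (suc n₁)) →
  ∃ λ L → length L ≤ m × Covers T (_≢ a) U U L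
delete₁ B T a with B (restrict (punchIn a) id id T)
... | L , len , cov = L , len , record
  { ∈₁₂ = λ i≢a _ → at₁₂ (avoids i≢a) ; ∈₁₃ = λ i≢a _ → at₁₃ (avoids i≢a) ; ∈₂₃ = ∈₂₃ cov }
  where
  at₁₂ : ∀ {i j} → (∃ λ i′ → punchIn a i′ ≡ i) → e₁₂ T i j ∈ L
  at₁₂ (_ , refl) = ∈₁₂ cov tt tt
  at₁₃ : ∀ {i k} → (∃ λ i′ → punchIn a i′ ≡ i) → e₁₃ T i k ∈ L
  at₁₃ (_ , refl) = ∈₁₃ cov tt tt

delete₁₂ : Bound K n₁ n₂ n₃ m → (T : Tri K (suc n₁) (suc n₂) n₃) →
  ∀ a b → ∃ λ L → length L ≤ m × Covers T (_≢ a) (_≢ b) U L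
delete₁₂ B T a b with B (restrict (punchIn a) (punchIn b) id T)
... | L , len , cov = L , len , record
  { ∈₁₂ = λ i≢a j≢b → at₁₂ (avoids i≢a) (avoids j≢b)
  ; ∈₁₃ = λ i≢a _ → at₁₃ (avoids i≢a)
  ; ∈₂₃ = λ j≢b _ → at₂₃ (avoids j≢b) }
  where
  at₁₂ : ∀ {i j} → (∃ λ i′ → punchIn a i′ ≡ i) → (∃ λ j′ → punchIn b j′ ≡ j) → e₁₂ T i j ∈ L
  at₁₂ (_ , refl) (_ , refl) = ∈₁₂ cov tt tt
  at₁₃ : ∀ {i k} → (∃ λ i′ → punchIn a i′ ≡ i) → e₁₃ T i k ∈ L
  at₁₃ (_ , refl) = ∈₁₃ cov tt tt
  at₂₃ : ∀ {j k} → (∃ λ j′ → punchIn b j′ ≡ j) → e₂₃ T j k ∈ L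
  at₂₃ (_ , refl) = ∈₂₃ cov tt tt

-- Undoes the deletion of `a`: `M` supplies the colours at `a` missing from `L`, at the price `m′`.
extend₁ : (T : Tri K n₁ n₂ n₃) → ∀ {a L} → length L ≤ m → Covers T (_≢ a) U U L →
  ∀ M → length M ≤ m′ → m′ + m ≤ t →
  (∀ j → e₁₂ T a j ∈ M ++ L) → (∀ k → e₁₃ T a k ∈ M ++ L) → Cover T t
extend₁ T {a} {L} lenL cov M lenM total a₁₂ a₁₃ = M ++ L ,
  ≤-trans (≤-reflexive (length-++ M)) (≤-trans (+-mono-≤ lenM lenL) total) , record
  { ∈₁₂ = λ {i} {j} _ _ → at₁₂ i j ; ∈₁₃ = λ {i} {k} _ _ → at₁₃ i k
  ; ∈₂₃ = λ _ _ → ∈-++⁺ʳ M (∈₂₃ cov tt tt) }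
  where
  at₁₂ : ∀ i j → e₁₂ T i j ∈ M ++ L
  at₁₂ i j with i ≟ a
  ... | yes refl = a₁₂ j
  ... | no i≢a = ∈-++⁺ʳ M (∈₁₂ cov i≢a tt)
  at₁₃ : ∀ i k → e₁₃ T i k ∈ M ++ L
  at₁₃ i k with i ≟ a
  ... | yes refl = a₁₃ k
  ... | no i≢a = ∈-++⁺ʳ M (∈₁₃ cov i≢a tt)

extend₁₂ : (T : Tri K n₁ n₂ n₃) → ∀ {a b L} → length L ≤ m → Covers T (_≢ a) (_≢ b) U L →
  ∀ M → length M ≤ m′ → m′ + m ≤ t →
  (∀ j → e₁₂ T a j ∈ M ++ L) → (∀ i → e₁₂ T i b ∈ M ++ L) →
  (∀ k → e₁₃ T a k ∈ M ++ L) → (∀ k → e₂₃ T b k ∈ M ++ L) → Cover T t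
extend₁₂ T {a} {b} {L} lenL cov M lenM total a₁₂ b₁₂ a₁₃ b₂₃ = M ++ L ,
  ≤-trans (≤-reflexive (length-++ M)) (≤-trans (+-mono-≤ lenM lenL) total) , record
  { ∈₁₂ = λ {i} {j} _ _ → at₁₂ i j ; ∈₁₃ = λ {i} {k} _ _ → at₁₃ i k
  ; ∈₂₃ = λ {j} {k} _ _ → at₂₃ j k }
  where
  at₁₂ : ∀ i j → e₁₂ T i j ∈ M ++ L
  at₁₂ i j with i ≟ a | j ≟ b
  ... | yes refl | _ = a₁₂ j
  ... | _ | yes refl = b₁₂ i
  ... | no i≢a | no j≢b = ∈-++⁺ʳ M (∈₁₂ cov i≢a j≢b)
  at₁₃ : ∀ i k → e₁₃ T i k ∈ M ++ L
  at₁₃ i k with i ≟ a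
  ... | yes refl = a₁₃ k
  ... | no i≢a = ∈-++⁺ʳ M (∈₁₃ cov i≢a tt)
  at₂₃ : ∀ j k → e₂₃ T j k ∈ M ++ L
  at₂₃ j k with j ≟ b
  ... | yes refl = b₂₃ k
  ... | no j≢b = ∈-++⁺ʳ M (∈₂₃ cov j≢b tt)

∈-tabulate-++ : (φ : Fin n → Fin K) (L : List (Fin K)) → ∀ i → φ i ∈ tabulate φ ++ L
∈-tabulate-++ φ L i = ∈-++⁺ˡ (∈-tabulate⁺ i)

-- Saves the one entry that is already in `L`; several counts below are tight up to exactly one
-- colour.
∈-tabulate-punchIn : (φ : Fin (suc n) → Fin K) (L : List (Fin K)) → ∀ a → φ a ∈ L →
  ∀ i → φ i ∈ tabulate (φ ∘ punchIn a) ++ L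
∈-tabulate-punchIn φ L a φa∈L i with i ≟ a
... | yes refl = ∈-++⁺ʳ (tabulate (φ ∘ punchIn a)) φa∈L
... | no i≢a with avoids i≢a
...   | i′ , refl = ∈-++⁺ˡ (∈-tabulate⁺ i′)

-- Lost colours

data Spread (φ : Fin n → Fin K) (L : List (Fin K)) : Set where
  none : (∀ i → φ i ∈ L) → Spread φ L
  one  : ∀ i → φ i ∉ L → (∀ j → φ j ∈ φ i ∷ L) → Spread φ L
  two  : ∀ i j → φ i ∉ L → φ j ∉ L → φ i ≢ φ j → Spread φ L

all-members : {φ : Fin n → Fin K} {L : List (Fin K)} → ¬ (∃ λ i → φ i ∉ L) → ∀ i → φ i ∈ L
all-members {φ = φ} {L} ¬∃ i = decidable-stable (_∈?_ _≟_ (φ i) L) λ φi∉L → ¬∃ (i , φi∉L)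

spread : (φ : Fin n → Fin K) (L : List (Fin K)) → Spread φ L
spread φ L with any? (λ i → ¬? (_∈?_ _≟_ (φ i) L))
... | no ¬∃ = none (all-members ¬∃)
... | yes (i , φi∉L) with any? (λ j → ¬? (_∈?_ _≟_ (φ j) (φ i ∷ L)))
...   | no ¬∃ = one i φi∉L (all-members ¬∃)
...   | yes (j , φj∉) = two i j φi∉L (φj∉ ∘ there) λ eq → φj∉ (here (sym eq))

Twins : (Fin m → Fin n → Fin K) → Set
Twins φ = ∃₂ λ x y → x ≢ y × ∀ k → φ x k ≡ φ y k

-- A vertex with lost colours on edges to two vertices of the same part.
record Double (φ : Fin m → Fin n → Fin K) (ψ : Fin n → Fin m′ → Fin K) : Set where
  field
    {list}       : List (Fin K)
    centre       : Fin m
    first second : Fin n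
    first∉       : φ centre first ∉ list
    second∉      : φ centre second ∉ list
    distinct     : φ centre first ≢ φ centre second
    rest∈        : ∀ j k → ψ j k ∈ list

-- A vertex with exactly one lost colour towards each of the other two parts.
record Mixed (T : Tri K n₁ n₂ n₃) (a : Fin n₁) (m : ℕ) : Set where
  field
    {list}   : List (Fin K)
    length≤  : length list ≤ m
    covers   : Covers T (_≢ a) U U list
    b        : Fin n₂
    c        : Fin n₃
    ab∉      : e₁₂ T a b ∉ list
    ac∉      : e₁₃ T a c ∉ list
    distinct : e₁₂ T a b ≢ e₁₃ T a c
    only₁₂   : ∀ j → e₁₂ T a j ∈ e₁₂ T a b ∷ list
    only₁₃   : ∀ k → e₁₃ T a k ∈ e₁₃ T a c ∷ list

-- A single lost colour fits into the budget `t`. Two distinct ones go either to the same part or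
-- one to each of the other parts.
classify : (T : Tri K n₁ n₂ n₃) → ∀ {a L} → length L ≤ m → Covers T (_≢ a) U U L → suc m ≤ t →
  Cover T t ⊎ Double (e₁₂ T) (e₂₃ T) ⊎ Double (e₁₃ T) (flip (e₂₃ T)) ⊎ Mixed T a m
classify T {a} {L} len cov m<t with spread (e₁₂ T a) L | spread (e₁₃ T a) L
... | two x y x∉ y∉ x≢y | _ = inj₂ (inj₁ record
  { centre = a ; first = x ; second = y ; first∉ = x∉ ; second∉ = y∉ ; distinct = x≢y
  ; rest∈ = λ _ _ → ∈₂₃ cov tt tt })
... | none _ | two x y x∉ y∉ x≢y = inj₂ (inj₂ (inj₁ record
  { centre = a ; first = x ; second = y ; first∉ = x∉ ; second∉ = y∉ ; distinct = x≢y
  ; rest∈ = λ _ _ → ∈₂₃ cov tt tt }))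
... | one _ _ _ | two x y x∉ y∉ x≢y = inj₂ (inj₂ (inj₁ record
  { centre = a ; first = x ; second = y ; first∉ = x∉ ; second∉ = y∉ ; distinct = x≢y
  ; rest∈ = λ _ _ → ∈₂₃ cov tt tt }))
... | none all₁₂ | none all₁₃ = inj₁ (extend₁ T len cov [] z≤n (≤-trans (m≤n+m _ 1) m<t) all₁₂ all₁₃)
... | none all₁₂ | one c _ all₁₃ =
  inj₁ (extend₁ T len cov (e₁₃ T a c ∷ []) ≤-refl m<t (there ∘ all₁₂) all₁₃)
... | one b _ all₁₂ | none all₁₃ =
  inj₁ (extend₁ T len cov (e₁₂ T a b ∷ []) ≤-refl m<t all₁₂ (there ∘ all₁₃))
... | one b b∉ all₁₂ | one c c∉ all₁₃ with e₁₂ T a b ≟ e₁₃ T a c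
...   | yes ab≡ac = inj₁ (extend₁ T len cov (e₁₂ T a b ∷ []) ≤-refl m<t all₁₂
                      λ k → subst (λ x → e₁₃ T a k ∈ x ∷ L) (sym ab≡ac) (all₁₃ k))
...   | no ab≢ac = inj₂ (inj₂ (inj₂ record
  { length≤ = len ; covers = cov ; b = b ; c = c ; ab∉ = b∉ ; ac∉ = c∉ ; distinct = ab≢ac
  ; only₁₂ = all₁₂ ; only₁₃ = all₁₃ }))

-- In the cycle `a b i c` both edges at `a` have lost colours, so the two edges at `i` must agree.
mixed-agree : {T : Tri K n₁ n₂ n₃} → ∀ {a} (M : Mixed T a m) → ∀ {i} → i ≢ a →
  e₁₂ T i (Mixed.b M) ≡ e₁₃ T i (Mixed.c M)
mixed-agree {T = T} {a} M {i} i≢a =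
  forced (exchange (transpose (cycle₁ T a i b c))) ab∉ ac∉ distinct (∈₁₂ covers i≢a tt) (∈₁₃ covers i≢a tt)
  where open Mixed M

-- The cycle through `centre`, `first`, `k` and `second` has two lost colours at `centre`, so its
-- edges at `k` agree.
double⇒twins : (T : Tri K n₁ n₂ n₃) → Double (e₁₂ T) (e₂₃ T) → Twins (e₂₃ T)
double⇒twins T D = first , second , distinct ∘ cong (e₁₂ T centre) , λ k →
  forced (exchange (cycle₂ T first second centre k)) first∉ second∉ distinct (rest∈ first k) (rest∈ second k)
  where open Double D

-- Deleting a twin only loses colours on its edges to the part on which the twins may differ.
twins⇒double : Bound K n₁ n₂ n₃ m → suc m ≤ t → (T : Tri K n₁ (suc n₂) n₃) → Twins (e₂₃ T) →
  Cover T t ⊎ Double (flip (e₁₂ T)) (e₁₃ T)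
twins⇒double B m<t T (x , y , x≢y , xy) with delete₁ (bound₁₂ B) (swap₁₂ T) x
... | L , len , cov with spread (λ i → e₁₂ T i x) L
...   | none all = inj₁ (unswap₁₂ (extend₁ (swap₁₂ T) len cov [] z≤n (≤-trans (m≤n+m _ 1) m<t) all
          λ k → subst (_∈ L) (sym (xy k)) (∈₁₃ cov (x≢y ∘ sym) tt)))
...   | one i _ all = inj₁ (unswap₁₂ (extend₁ (swap₁₂ T) len cov (e₁₂ T i x ∷ []) ≤-refl m<t all
          λ k → there (subst (_∈ L) (sym (xy k)) (∈₁₃ cov (x≢y ∘ sym) tt))))
...   | two i j i∉ j∉ i≢j = inj₂ record
  { centre = x ; first = i ; second = j ; first∉ = i∉ ; second∉ = j∉ ; distinct = i≢j
  ; rest∈ = λ _ _ → ∈₂₃ cov tt tt }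

collect : ∀ {X : Set} {P : Fin n → Set} → (∀ i → X ⊎ P i) → X ⊎ (∀ i → P i)
collect {n = zero} d = inj₂ λ ()
collect {n = suc n} d with d zero | collect (d ∘ suc)
... | inj₁ x | _ = inj₁ x
... | inj₂ _ | inj₁ x = inj₁ x
... | inj₂ p | inj₂ q = inj₂ λ { zero → p ; (suc i) → q i }

head-∈ : ∀ {A : Set} {x y : A} {L} → x ∈ y ∷ L → x ∉ L → x ≡ y
head-∈ (here eq) _ = eq
head-∈ (there x∈L) x∉L = contradiction x∈L x∉L

-- The private edges of the mixed vertices form a perfect matching of parts 1 and 2.
-- At the mate a of a twin x, the other twin carries the same private colour,
-- but it is matched elsewhere.
mixed⇒¬twins : (T : Tri K (suc n) (suc n) n₃) → (∀ a → Mixed T a m) → ¬ Twins (flip (e₁₂ T))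
mixed⇒¬twins {n = n} T M (x , y , x≢y , xy) = unmatched x
  λ { (a , refl) → unmatched y
  λ { (a′ , refl) → foreign (λ { refl → x≢y refl })
        (λ ∈L → Mixed.ab∉ (M a) (subst (_∈ Mixed.list (M a)) (sym (xy a)) ∈L)) } }
  where
  mate : Fin (suc n) → Fin (suc n)
  mate a = Mixed.b (M a)
  -- The edges from `a` to the two partners of `a′` share a colour. Were it lost at `a`, `only₁₂`
  -- and `only₁₃` would identify the two distinct colours lost there.
  foreign : ∀ {a a′} → a ≢ a′ → ¬ (e₁₂ T a (mate a′) ∉ Mixed.list (M a))
  foreign {a} {a′} a≢a′ private₁₂ = Mixed.distinct (M a) (trans
    (sym (head-∈ (Mixed.only₁₂ (M a) (mate a′)) private₁₂))
    (trans agree (head-∈ (Mixed.only₁₃ (M a) _) (private₁₂ ∘ subst (_∈ _) (sym agree)))))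
    where
    agree : e₁₂ T a (mate a′) ≡ e₁₃ T a (Mixed.c (M a′))
    agree = mixed-agree (M a′) a≢a′
  mate-injective : ∀ {a a′} → mate a ≡ mate a′ → a ≡ a′
  mate-injective {a} {a′} eq = decidable-stable (a ≟ a′) λ a≢a′ →
    foreign a≢a′ λ ∈L → Mixed.ab∉ (M a) (subst (λ z → e₁₂ T a z ∈ Mixed.list (M a)) (sym eq) ∈L)
  -- Without a mate for `z`, `mate` would inject `Fin (suc n)` into `Fin n`.
  unmatched : ∀ z → ¬ ¬ (∃ λ a → mate a ≡ z)
  unmatched z ¬∃ with pigeonhole (n<1+n n) (λ a → punchOut {i = z} {j = mate a} λ eq → ¬∃ (a , sym eq))
  ... | a , a′ , a<a′ , eq = <⇒≢ a<a′ (mate-injective (punchOut-injective {i = z} _ _ eq))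

-- One of the four remaining pairs coincides, and each such coincidence leaves at most one colour of
-- `p` and `r` outside `q` and `s`; this is `x`.
third-colour : ∀ {p q r s : Fin K} → NonRainbow p q r s → q ≢ r → q ≢ s →
  ∃ λ x → p ∈ s ∷ q ∷ x ∷ [] × r ∈ s ∷ q ∷ x ∷ []
third-colour {p = p} {q} {r} {s} N q≢r q≢s with p ≟ q | p ≟ s | r ≟ s | r ≟ p
... | yes p≡q | _ | _ | _ = r , there (here p≡q) , there (there (here refl))
... | _ | yes p≡s | _ | _ = r , here p≡s , there (there (here refl))
... | _ | _ | yes r≡s | _ = p , there (there (here refl)) , here r≡s
... | _ | _ | _ | yes r≡p = p , there (there (here refl)) , there (there (here r≡p))
... | no p≢q | no p≢s | no r≢s | no r≢p =
  ⊥-elim (N p≢q (r≢p ∘ sym) p≢s q≢r q≢s r≢s)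

-- Three parts of equal size

module Balanced {N t₂ : ℕ}
  -- Against the target `suc t`, reinserting one vertex may cost one colour; reinserting two from
  -- different parts may cost `N + 3`, one more than the size of a part.
  (B₁ : Bound K (suc N) (suc (suc N)) (suc (suc N)) t)
  (B₂ : Bound K (suc N) (suc N) (suc (suc N)) t₂)
  (fits : suc (suc (suc N)) + t₂ ≤ suc t) where

  Coloured : Set
  Coloured = Tri K (suc (suc N)) (suc (suc N)) (suc (suc N))

  -- The lost colours after deleting y and w are on edges to the third part.  There
  -- is a lost colour on some yv, so by the cycle y k w v at most one of the colours
  -- of ky and kw, for each k, is not among those of yv and wv.
  opposite-twins⇒cover : (T : Coloured) → Twins (e₁₂ T) → Twins (flip (e₁₂ T)) → Cover T (suc t)
  opposite-twins⇒cover T (y , y′ , y≢y′ , yy′) (w , w′ , w≢w′ , ww′) with delete₁ B₁ T y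
  ... | L , len , cov with any? (λ k → ¬? (_∈?_ _≟_ (e₁₃ T y k) L))
  ...   | no ¬∃ = extend₁ T len cov [] z≤n (m≤n+m _ 1)
            (λ j → subst (_∈ L) (sym (yy′ j)) (∈₁₂ cov (y≢y′ ∘ sym) tt)) (all-members ¬∃)
  ...   | yes (v , v∉) with delete₁₂ B₂ T y w
  ...     | L₂ , len₂ , cov₂ = extend₁₂ T len₂ cov₂ M
              (s≤s (s≤s (≤-reflexive (length-tabulate φ)))) fits
              (λ j → ∈-++⁺ʳ M (row j)) (λ i → ∈-++⁺ʳ M (column i))
              (λ k → ∈-++⁺ˡ (proj₁ (both k))) (λ k → ∈-++⁺ˡ (proj₂ (both k)))
    where
    shared : ∀ k → ∃ λ x → e₁₃ T y k ∈ e₂₃ T w v ∷ e₁₃ T y v ∷ x ∷ []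
                         × e₂₃ T w k ∈ e₂₃ T w v ∷ e₁₃ T y v ∷ x ∷ []
    shared k = third-colour (cycle₃ T k v y w)
      (separated (∈₂₃ cov tt tt) v∉ ∘ sym) (separated (∈₂₃ cov tt tt) v∉ ∘ sym)
    φ : Fin (suc N) → Fin K
    φ k = proj₁ (shared (punchIn v k))
    M : List (Fin K)
    -- Two colours at `v` and one for each of the `N + 1` other vertices of part 3: exactly the
    -- budget.
    M = e₂₃ T w v ∷ e₁₃ T y v ∷ tabulate φ
    include : ∀ k {x} → x ∈ e₂₃ T w v ∷ e₁₃ T y v ∷ φ k ∷ [] → x ∈ M
    include k (here eq) = here eq
    include k (there (here eq)) = there (here eq)
    include k (there (there (here refl))) = there (there (∈-tabulate⁺ {f = φ} k))
    both : ∀ k → e₁₃ T y k ∈ M × e₂₃ T w k ∈ M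
    both k with k ≟ v
    ... | yes refl = there (here refl) , here refl
    ... | no k≢v with avoids k≢v
    ...   | k′ , refl = include k′ (proj₁ (proj₂ (shared k))) , include k′ (proj₂ (proj₂ (shared k)))
    row : ∀ j → e₁₂ T y j ∈ L₂
    row j with j ≟ w
    ... | no j≢w = subst (_∈ L₂) (sym (yy′ j)) (∈₁₂ cov₂ (y≢y′ ∘ sym) j≢w)
    -- The edge between the two deleted vertices: replacing `y` by `y′` and `w` by `w′` reaches a
    -- surviving edge of the same colour.
    ... | yes refl = subst (_∈ L₂) (trans (sym (ww′ y′)) (sym (yy′ w))) (∈₁₂ cov₂ (y≢y′ ∘ sym) (w≢w′ ∘ sym))
    column : ∀ i → e₁₂ T i w ∈ L₂
    column i with i ≟ y
    ... | no i≢y = subst (_∈ L₂) (sym (ww′ i)) (∈₁₂ cov₂ i≢y (w≢w′ ∘ sym))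
    ... | yes refl = row w

  -- Reinserting a twin of part 2 costs at most one colour, unless it is itself double towards part
  -- 1 and so yields twins there.
  double⇒both-twins : (T : Coloured) → Double (e₁₂ T) (e₂₃ T) →
    Cover T (suc t) ⊎ Twins (e₂₃ T) × Twins (e₁₃ T)
  double⇒both-twins T D with twins⇒double (bound₁₂ B₁) ≤-refl T (double⇒twins T D)
  ... | inj₁ done = inj₁ done
  ... | inj₂ D′ = inj₂ (double⇒twins T D , double⇒twins (swap₁₂ T) D′)

  -- A double vertex yields twins in two parts with respect to the third part.  The
  -- vertices of the third part cannot all be mixed, and a double one among them
  -- yields further twins, of which some are opposite to the first.
  double⇒cover : (T : Coloured) → Double (e₁₂ T) (e₂₃ T) → Cover T (suc t)
  double⇒cover T D with double⇒both-twins T D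
  ... | inj₁ done = done
  -- The first digit is the part of the twins, the second the part towards which they agree. Below,
  -- `twins₃₂` is opposite to `twins₂₃`, and `twins₃₁` to `twins₁₃`.
  ... | inj₂ (twins₂₃ , twins₁₃) with collect classified
    where
    T₃ : Coloured
    T₃ = swap₁₂ (swap₂₃ T)
    classified : ∀ c → (Cover T (suc t) ⊎ Double (e₁₂ T₃) (e₂₃ T₃) ⊎ Double (e₁₃ T₃) (flip (e₂₃ T₃))) ⊎ Mixed T₃ c t
    classified c with delete₁ B₁ T₃ c
    ... | _ , len , cov with classify T₃ len cov ≤-refl
    ...   | inj₁ done = inj₁ (inj₁ (unswap₂₃ (unswap₁₂ done)))
    ...   | inj₂ (inj₁ D₁) = inj₁ (inj₂ (inj₁ D₁))
    ...   | inj₂ (inj₂ (inj₁ D₂)) = inj₁ (inj₂ (inj₂ D₂))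
    ...   | inj₂ (inj₂ (inj₂ M)) = inj₂ M
  ...   | inj₁ (inj₁ done) = done
  ...   | inj₂ M = contradiction twins₁₃ (mixed⇒¬twins (swap₁₂ (swap₂₃ T)) M)
  ...   | inj₁ (inj₂ (inj₁ D₁)) with double⇒both-twins (swap₁₂ (swap₂₃ T)) D₁
  ...     | inj₁ done = unswap₂₃ (unswap₁₂ done)
  ...     | inj₂ (_ , twins₃₂) =
    unswap₁₂ (unswap₂₃ (opposite-twins⇒cover (swap₂₃ (swap₁₂ T)) twins₂₃ twins₃₂))
  double⇒cover T D | inj₂ (twins₂₃ , twins₁₃) | inj₁ (inj₂ (inj₂ D₂))
    with double⇒both-twins (swap₂₃ (swap₁₂ (swap₂₃ T))) D₂
  ...     | inj₁ done = unswap₂₃ (unswap₁₂ (unswap₂₃ done))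
  ...     | inj₂ (_ , twins₃₁) = unswap₂₃ (opposite-twins⇒cover (swap₂₃ T) twins₁₃ twins₃₁)

  mixed : (T : Coloured) → ∀ a → Cover T (suc t) ⊎ Mixed T a t
  mixed T a with delete₁ B₁ T a
  ... | _ , len , cov with classify T len cov ≤-refl
  ...   | inj₁ done = inj₁ done
  ...   | inj₂ (inj₁ D) = inj₁ (double⇒cover T D)
  ...   | inj₂ (inj₂ (inj₁ D)) = inj₁ (unswap₂₃ (double⇒cover (swap₂₃ T) D))
  ...   | inj₂ (inj₂ (inj₂ M)) = inj₂ M

  -- What the cycles through a mixed vertex a with mixed partners b and c enforce.
  -- Deleting b and a leaves the colours of ab, ac and b's edges to the third part.
  record Hub (T : Coloured) (a b c : Fin (suc (suc N))) : Set where
    field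
      agree₁ : ∀ {i} → i ≢ a → e₁₂ T i b ≡ e₁₃ T i c
      agree₂ : ∃ λ γ → ∀ {j} → j ≢ b → e₁₂ T a j ≡ e₂₃ T j γ
      agree₃ : ∃ λ β → ∀ {k} → k ≢ c → e₁₃ T a k ≡ e₂₃ T β k
  open Hub

  swap-hub : ∀ {T a b c} → Hub T a b c → Hub (swap₂₃ T) a c b
  swap-hub H = record { agree₁ = sym ∘ agree₁ H ; agree₂ = agree₃ H ; agree₃ = agree₂ H }

  -- By the hub equations every other edge at `a` or `b` has the colour of an edge avoiding both or,
  -- if `β` is `b`, of an edge from `b` to part 3.
  hub-extend : ∀ {T a b c L} → Hub T a b c → length L ≤ t₂ → Covers T (_≢ a) (_≢ b) U L →
    ∀ M → length M ≤ suc (suc (suc N)) → e₁₂ T a b ∈ M ++ L → e₁₃ T a c ∈ M ++ L →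
    (∀ k → e₂₃ T b k ∈ M ++ L) → Cover T (suc t)
  hub-extend {T} {a} {b} {c} {L} H len cov M lenM ab∈ ac∈ b∈ =
    extend₁₂ T len cov M lenM fits a₁₂ b₁₂ a₁₃ b∈
    where
    a₁₂ : ∀ j → e₁₂ T a j ∈ M ++ L
    a₁₂ j with j ≟ b
    ... | yes refl = ab∈
    ... | no j≢b = ∈-++⁺ʳ M (subst (_∈ L) (sym (proj₂ (agree₂ H) j≢b)) (∈₂₃ cov j≢b tt))
    b₁₂ : ∀ i → e₁₂ T i b ∈ M ++ L
    b₁₂ i with i ≟ a
    ... | yes refl = ab∈
    ... | no i≢a = ∈-++⁺ʳ M (subst (_∈ L) (sym (agree₁ H i≢a)) (∈₁₃ cov i≢a tt))
    a₁₃ : ∀ k → e₁₃ T a k ∈ M ++ L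
    a₁₃ k with k ≟ c | proj₁ (agree₃ H) ≟ b
    ... | yes refl | _ = ac∈
    ... | no k≢c | yes β≡b = subst (_∈ M ++ L) (sym (trans (proj₂ (agree₃ H) k≢c) (cong (λ x → e₂₃ T x k) β≡b))) (b∈ k)
    ... | no k≢c | no β≢b = ∈-++⁺ʳ M (subst (_∈ L) (sym (proj₂ (agree₃ H) k≢c)) (∈₂₃ cov β≢b tt))

  -- The edges `ab`, `ac` and all `bk` are one too many for the budget. If none of the tests saves a
  -- colour, `ab` and each `bk` have distinct lost colours, and the cycle `b a j k` forces the
  -- equation.
  hub-rigid : ∀ {T a b c} → Hub T a b c → Cover T (suc t) ⊎ (∀ {j} → j ≢ b → ∀ k → e₁₂ T a j ≡ e₂₃ T j k)
  hub-rigid {T} {a} {b} {c} H with delete₁₂ B₂ T a b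
  ... | L , len , cov with _∈?_ _≟_ (e₁₂ T a b) (tabulate (e₂₃ T b) ++ L)
  ...   | yes ab∈ = inj₁ (hub-extend H len cov (e₁₃ T a c ∷ tabulate (e₂₃ T b))
            (s≤s (≤-reflexive (length-tabulate (e₂₃ T b)))) (there ab∈) (here refl)
            (there ∘ ∈-tabulate-++ (e₂₃ T b) L))
  ...   | no ab∉ with any? (λ k → _∈?_ _≟_ (e₂₃ T b k) L)
  ...     | yes (k , bk∈) = inj₁ (hub-extend H len cov
              (e₁₂ T a b ∷ e₁₃ T a c ∷ tabulate (e₂₃ T b ∘ punchIn k))
              (s≤s (s≤s (≤-reflexive (length-tabulate (e₂₃ T b ∘ punchIn k))))) (here refl) (there (here refl))
              (λ k′ → there (there (∈-tabulate-punchIn (e₂₃ T b) L k bk∈ k′))))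
  ...     | no ¬∃ = inj₂ λ {j} j≢b k → forced (exchange (transpose (cycle₂ T b j a k)))
              (ab∉ ∘ ∈-++⁺ʳ (tabulate (e₂₃ T b))) (λ bk∈ → ¬∃ (k , bk∈))
              (λ ab≡bk → ab∉ (subst (_∈ tabulate (e₂₃ T b) ++ L) (sym ab≡bk) (∈-tabulate-++ (e₂₃ T b) L k)))
              (subst (_∈ L) (sym (proj₂ (agree₂ H) j≢b)) (∈₂₃ cov j≢b tt)) (∈₂₃ cov j≢b tt)

  -- Rigidity with `b` and `c` exchanged gives all edges from part 2 to a given `k ≢ c` one colour,
  -- so `bk` repeats a surviving edge. Only `ab`, `ac` and `bc` are left to pay for.
  hub⇒cover : ∀ {T a b c} → Hub T a b c → Cover T (suc t)
  hub⇒cover {T} {a} {b} {c} H with hub-rigid (swap-hub H)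
  ... | inj₁ done = unswap₂₃ done
  ... | inj₂ rigid with delete₁₂ B₂ T a b
  ...   | L , len , cov = hub-extend H len cov M (s≤s (s≤s (s≤s z≤n)))
            (here refl) (there (here refl)) b∈
    where
    M : List (Fin K)
    M = e₁₂ T a b ∷ e₁₃ T a c ∷ e₂₃ T b c ∷ []
    b∈ : ∀ k → e₂₃ T b k ∈ M ++ L
    b∈ k with k ≟ c
    ... | yes refl = there (there (here refl))
    ... | no k≢c = ∈-++⁺ʳ M (subst (_∈ L) (trans (sym (rigid k≢c (punchIn b zero))) (rigid k≢c b))
                     (∈₂₃ cov (punchInᵢ≢i b zero) tt))

  -- The mate of `b` in part 1 is `a`: for any other vertex `i`, the edge `ib` has the colour of
  -- `ic`, which avoids `b` and so is not lost.
  mixed-at-hub : ∀ {T : Coloured} {a b c} → (∀ {i} → i ≢ a → e₁₂ T i b ≡ e₁₃ T i c) →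
    Mixed (swap₁₂ T) b m → ∃ λ γ → ∀ {j} → j ≢ b → e₁₂ T a j ≡ e₂₃ T j γ
  mixed-at-hub {T = T} {a} {b} agree M with Mixed.b M ≟ a
  ... | yes refl = Mixed.c M , mixed-agree M
  ... | no α≢a = contradiction
    (subst (_∈ Mixed.list M) (sym (agree α≢a)) (∈₂₃ (Mixed.covers M) tt tt)) (Mixed.ab∉ M)

  balanced : Bound K (suc (suc N)) (suc (suc N)) (suc (suc N)) (suc t)
  balanced T with mixed T zero
  ... | inj₁ done = done
  ... | inj₂ M with mixed (swap₁₂ T) (Mixed.b M) | mixed (swap₁₂ (swap₂₃ T)) (Mixed.c M)
  ...   | inj₁ done | _ = unswap₁₂ done
  ...   | inj₂ _ | inj₁ done = unswap₂₃ (unswap₁₂ done)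
  ...   | inj₂ Mb | inj₂ Mc = hub⇒cover {T} record
    { agree₁ = mixed-agree M
    ; agree₂ = mixed-at-hub {T = T} (mixed-agree M) Mb
    ; agree₃ = mixed-at-hub {T = swap₂₃ T} (sym ∘ mixed-agree M) Mc }

-- Unequal parts

-- The edges from `x` to part 3 repeat colours at `y`, so at most one colour per vertex of part 1 is
-- lost.
delete-twin : Bound K n₂ n₁ n₃ m → n₁ + m ≤ t → (T : Tri K n₁ (suc n₂) n₃) → Twins (e₂₃ T) → Cover T t
delete-twin B total T (x , y , x≢y , xy) with delete₁ B (swap₁₂ T) x
... | L , len , cov = unswap₁₂ (extend₁ (swap₁₂ T) len cov (tabulate φ)
  (≤-reflexive (length-tabulate φ)) total (∈-tabulate-++ φ L)
  λ k → ∈-++⁺ʳ (tabulate φ) (subst (_∈ L) (sym (xy k)) (∈₁₃ cov (x≢y ∘ sym) tt)))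
  where
  φ = λ i → e₁₂ T i x

-- Twins are affordable because deleting one loses only colours towards part 1, the smallest. At a
-- mixed vertex, deleting `b` or `c` exceeds its budget by at most one colour, since `mixed-agree`
-- provides for the other edges to part 1.
bound-smallest-part : ∀ {s p q m₁ m₂ m₃} →
  Bound K s (suc (suc p)) (suc q) m₁ → suc m₁ ≤ t →
  Bound K (suc p) (suc s) (suc q) m₂ → suc q + m₂ ≤ t → suc s ≤ suc q →
  Bound K q (suc s) (suc (suc p)) m₃ → suc (suc p) + m₃ ≤ t → suc s ≤ suc (suc p) →
  Bound K (suc s) (suc (suc p)) (suc q) t
bound-smallest-part {K} {t} {m₂ = m₂} {m₃} B₁ total₁ B₂ total₂ s≤q B₃ total₃ s≤p T with delete₁ B₁ T zero
... | _ , len , cov with classify T len cov total₁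
...   | inj₁ done = done
...   | inj₂ (inj₁ D) = delete-twin B₂ (≤-trans (+-monoˡ-≤ m₂ s≤q) total₂) T (double⇒twins T D)
...   | inj₂ (inj₂ (inj₁ D)) = unswap₂₃ (delete-twin B₃ (≤-trans (+-monoˡ-≤ m₃ s≤p) total₃)
        (swap₂₃ T) (double⇒twins (swap₂₃ T) D))
...   | inj₂ (inj₂ (inj₂ M)) = centred
  where
  open Mixed M using (b; c)
  a = zero
  -- Any vertex of part 2 other than `b` would do.
  b′ = punchIn b zero
  b′≢b : b′ ≢ b
  b′≢b = punchInᵢ≢i b zero

  centred : Cover T t
  centred with delete₁ B₂ (swap₁₂ T) b | delete₁ B₃ (swap₁₂ (swap₂₃ T)) c
  ... | L , len , cov | L′ , len′ , cov′
    with _∈?_ _≟_ (e₁₂ T a b) (tabulate (e₂₃ T b) ++ L) | _∈?_ _≟_ (e₂₃ T b c) L | _∈?_ _≟_ (e₂₃ T b′ c) L′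
  ... | yes ab∈ | _ | _ = unswap₁₂ (extend₁ (swap₁₂ T) len cov (tabulate (e₂₃ T b))
          (≤-reflexive (length-tabulate (e₂₃ T b))) total₂ edges (∈-tabulate-++ (e₂₃ T b) L))
    where
    edges : ∀ i → e₁₂ T i b ∈ tabulate (e₂₃ T b) ++ L
    edges i with i ≟ a
    ... | yes refl = ab∈
    ... | no i≢a = ∈-++⁺ʳ (tabulate (e₂₃ T b)) (subst (_∈ L) (sym (mixed-agree M i≢a)) (∈₂₃ cov tt tt))
  ... | no _ | yes bc∈ | _ = unswap₁₂ (extend₁ (swap₁₂ T) len cov (e₁₂ T a b ∷ tabulate φ)
          (s≤s (≤-reflexive (length-tabulate φ))) total₂ edges
          λ k → there (∈-tabulate-punchIn (e₂₃ T b) L c bc∈ k))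
    where
    φ = e₂₃ T b ∘ punchIn c
    edges : ∀ i → e₁₂ T i b ∈ e₁₂ T a b ∷ tabulate φ ++ L
    edges i with i ≟ a
    ... | yes refl = here refl
    ... | no i≢a = there (∈-++⁺ʳ (tabulate φ) (subst (_∈ L) (sym (mixed-agree M i≢a)) (∈₂₃ cov tt tt)))
  ... | no _ | no _ | yes b′c∈ = unswap₂₃ (unswap₁₂ (extend₁ (swap₁₂ (swap₂₃ T)) len′ cov′
          (e₁₃ T a c ∷ tabulate φ) (s≤s (≤-reflexive (length-tabulate φ))) total₃ edges
          λ j → there (∈-tabulate-punchIn (λ j → e₂₃ T j c) L′ b′ b′c∈ j)))
    where
    φ = λ j → e₂₃ T (punchIn b′ j) c
    edges : ∀ i → e₁₃ T i c ∈ e₁₃ T a c ∷ tabulate φ ++ L′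
    edges i with i ≟ a
    ... | yes refl = here refl
    ... | no i≢a = there (∈-++⁺ʳ (tabulate φ) (subst (_∈ L′) (mixed-agree M i≢a) (∈₂₃ cov′ tt tt)))
  -- Nothing can be saved at `b` or `c`; the failed tests make the cycle `b a b′ c` rainbow.
  ... | no ab∉ | no bc∉ | no b′c∉ = ⊥-elim (cycle₂ T b b′ a c
    (separated ab′∈ ab∉L ∘ sym)
    (λ ab≡bc → ab∉ (subst (_∈ tabulate (e₂₃ T b) ++ L) (sym ab≡bc) (∈-tabulate-++ (e₂₃ T b) L c)))
    (separated b′c∈ ab∉L ∘ sym)
    (separated ab′∈ bc∉)
    (separated (∈₂₃ cov′ tt tt) b′c∉)
    (separated b′c∈ bc∉ ∘ sym))
    where
    ab∉L : e₁₂ T a b ∉ L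
    ab∉L = ab∉ ∘ ∈-++⁺ʳ (tabulate (e₂₃ T b))
    ab′∈ : e₁₂ T a b′ ∈ L
    ab′∈ = ∈₁₂ cov b′≢b tt
    b′c∈ : e₂₃ T b′ c ∈ L
    b′c∈ = ∈₁₃ cov b′≢b tt

-- Reinserting a twin of part 2 may cost only one colour. If it costs more, the twin is double
-- towards part 1 and yields twins there, where one colour per vertex of part 2 is allowed.
double⇒cover-largest : ∀ {s p m₁ m₂} →
  Bound K p (suc (suc s)) (suc (suc s)) m₁ → suc (suc s) + m₁ ≤ t →
  Bound K (suc p) (suc s) (suc (suc s)) m₂ → suc m₂ ≤ t →
  (T : Tri K (suc p) (suc (suc s)) (suc (suc s))) → Double (e₁₂ T) (e₂₃ T) → Cover T t
double⇒cover-largest B₁ total₁ B₂ total₂ T D with twins⇒double B₂ total₂ T (double⇒twins T D)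
... | inj₁ done = done
... | inj₂ D′ = unswap₁₂ (delete-twin B₁ total₁ (swap₁₂ T) (double⇒twins (swap₁₂ T) D′))

mixed⇒cover : (T : Tri K n₁ n₂ n₃) → ∀ {a} → Mixed T a m → suc (suc m) ≤ t → Cover T t
mixed⇒cover T {a} M total = extend₁ T length≤ covers (e₁₂ T a b ∷ e₁₃ T a c ∷ []) ≤-refl total
  (λ j → widen (only₁₂ j)) (there ∘ only₁₃)
  where
  open Mixed M
  widen : ∀ {x y z : Fin _} {L} → x ∈ y ∷ L → x ∈ y ∷ z ∷ L
  widen (here eq) = here eq
  widen (there x∈) = there (there x∈)

-- A vertex of part 1 may cost at least two colours, enough for a mixed one; only double vertices
-- need twins.
bound-largest-part : ∀ {s p m₁ m₂} →
  Bound K p (suc (suc s)) (suc (suc s)) m₁ → suc (suc s) + m₁ ≤ t →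
  Bound K (suc p) (suc s) (suc (suc s)) m₂ → suc m₂ ≤ t →
  Bound K (suc p) (suc (suc s)) (suc (suc s)) t
bound-largest-part {s = s} {m₁ = m₁} B₁ total₁ B₂ total₂ T with delete₁ B₁ T zero
... | _ , len , cov with classify T len cov (≤-trans (s≤s (m≤n+m m₁ (suc s))) total₁)
...   | inj₁ done = done
...   | inj₂ (inj₁ D) = double⇒cover-largest B₁ total₁ B₂ total₂ T D
...   | inj₂ (inj₂ (inj₁ D)) = unswap₂₃ (double⇒cover-largest B₁ total₁ B₂ total₂ (swap₂₃ T) D)
...   | inj₂ (inj₂ (inj₂ M)) = mixed⇒cover T M (≤-trans (s≤s (s≤s (m≤n+m m₁ s))) total₁)

-- With `c` the single vertex of part 3, `a` has one edge more than the budget `suc q`. It suffices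
-- that `ac` repeats a colour or that `ab` survives.
private-vertex : ∀ {q} → Bound K n (suc q) 1 m → suc q + m ≤ t → (T : Tri K (suc n) (suc q) 1) → ∀ a b →
  Cover T t ⊎ ∃ λ L → Covers T (_≢ a) U U L × e₁₂ T a b ∉ L × e₁₃ T a zero ∉ L × e₁₂ T a b ≢ e₁₃ T a zero
private-vertex B total T a b with delete₁ B T a
... | L , len , cov
  with _∈?_ _≟_ (e₁₃ T a zero) (tabulate (e₁₂ T a) ++ L) | _∈?_ _≟_ (e₁₂ T a b) L
... | yes ac∈ | _ = inj₁ (extend₁ T len cov (tabulate (e₁₂ T a)) (≤-reflexive (length-tabulate (e₁₂ T a))) total
        (∈-tabulate-++ (e₁₂ T a) L) λ { zero → ac∈ })
... | no _ | yes ab∈ = inj₁ (extend₁ T len cov (e₁₃ T a zero ∷ tabulate φ)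
        (s≤s (≤-reflexive (length-tabulate φ))) total
        (there ∘ ∈-tabulate-punchIn (e₁₂ T a) L b ab∈) λ { zero → here refl })
  where
  φ = e₁₂ T a ∘ punchIn b
... | no ac∉ | no ab∉ = inj₂ (L , cov , ab∉ , ac∉ ∘ ∈-++⁺ʳ (tabulate (e₁₂ T a)) ,
        λ ab≡ac → ac∉ (subst (_∈ tabulate (e₁₂ T a) ++ L) ab≡ac (∈-tabulate-++ (e₁₂ T a) L b)))

-- If no edge at a or a′ can be spared, a b a′ c is rainbow for all b and c.
bound-singleton-part : ∀ {q} → Bound K (suc n) (suc q) 1 m → suc q + m ≤ t → Bound K (suc (suc n)) (suc q) 1 t
bound-singleton-part B total T
  with private-vertex B total T zero zero | private-vertex B total T (suc zero) zero
... | inj₁ done | _ = done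
... | inj₂ _ | inj₁ done = done
... | inj₂ (_ , cov , ab∉ , ac∉ , ab≢ac) | inj₂ (_ , cov′ , a′b∉ , a′c∉ , a′b≢a′c) =
  ⊥-elim (cycle₁ T zero (suc zero) zero zero
    (separated a′b∈ ab∉ ∘ sym) ab≢ac (separated a′c∈ ab∉ ∘ sym)
    (separated a′b∈ ac∉) a′b≢a′c (separated a′c∈ ac∉ ∘ sym))
  where
  a′b∈ = ∈₁₂ cov (λ ()) tt
  a′c∈ = ∈₁₃ cov (λ ()) tt

bound-triangle : Bound K 1 1 1 3
bound-triangle T = e₁₂ T zero zero ∷ e₁₃ T zero zero ∷ e₂₃ T zero zero ∷ [] , ≤-refl , record
  { ∈₁₂ = λ { {zero} {zero} _ _ → here refl }
  ; ∈₁₃ = λ { {zero} {zero} _ _ → there (here refl) }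
  ; ∈₂₃ = λ { {zero} {zero} _ _ → there (there (here refl)) } }

-- The induction on the number of vertices

bound-≡ : m ≡ m′ → Bound K n₁ n₂ n₃ m → Bound K n₁ n₂ n₃ m′
bound-≡ refl B = B

-- The cases delete from different parts, hence `fuel`. Only `n₃` has to be smallest: the bound is
-- symmetric in `n₁` and `n₂`, so recursive calls need not sort them.
upper-bound : ∀ fuel n₁ n₂ n₃ → n₁ + n₂ + n₃ ≤ fuel → n₃ ≤ n₁ → n₃ ≤ n₂ → 1 ≤ n₃ →
  Bound K n₁ n₂ n₃ (n₁ * n₂ + n₃ + 1)
upper-bound (suc fuel) 1 1 1 size _ _ _ = bound-triangle
upper-bound (suc fuel) (suc (suc p)) (suc q) 1 size _ _ _ = bound-singleton-part
  (upper-bound fuel (suc p) (suc q) 1 (≤-pred size) (s≤s z≤n) (s≤s z≤n) ≤-refl)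
  (≤-reflexive (eq p q))
  where
  eq : ∀ p q → suc q + (suc p * suc q + 1 + 1) ≡ suc (suc p) * suc q + 1 + 1
  eq = solve-∀
upper-bound (suc fuel) 1 (suc (suc q)) 1 size _ _ _ = bound₁₂ (bound-singleton-part
  (bound₁₂ (upper-bound fuel 1 (suc q) 1 (≤-pred size) ≤-refl (s≤s z≤n) ≤-refl))
  (≤-reflexive (eq q)))
  where
  eq : ∀ q → 1 + (1 * suc q + 1 + 1) ≡ 1 * suc (suc q) + 1 + 1
  eq = solve-∀
upper-bound (suc _) 1 _ (suc (suc _)) _ (s≤s ())
upper-bound (suc _) (suc (suc _)) 1 (suc (suc _)) _ _ (s≤s ())
upper-bound (suc fuel) (suc (suc p)) (suc (suc q)) (suc (suc r)) size n₃≤n₁ n₃≤n₂ _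
  with m≤n⇒m<n∨m≡n n₃≤n₁ | m≤n⇒m<n∨m≡n n₃≤n₂
-- Part 3 is strictly smallest and stays smallest after any deletion. The bound drops by 1 for a
-- vertex of part 3, by `N₂` for part 1 and by `N₁` for part 2.
... | inj₁ n₃<n₁ | inj₁ n₃<n₂ = bound₂₃ (bound₁₂ (bound-smallest-part
  (bound₁₂ (bound₂₃ (upper-bound fuel N₁ N₂ (suc r) (≤-trans (≤-reflexive (size₃ p q r)) (≤-pred size))
    (≤-trans (n≤1+n _) n₃≤n₁) (≤-trans (n≤1+n _) n₃≤n₂) (s≤s z≤n))))
  (≤-reflexive (total₁ p q r))
  (bound₂₃ (upper-bound fuel (suc p) N₂ N₃ (≤-pred size) (≤-pred n₃<n₁) n₃≤n₂ (s≤s z≤n)))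
  (≤-reflexive (total₂ p q r)) n₃≤n₂
  (bound₂₃ (bound₁₂ (upper-bound fuel N₁ (suc q) N₃ (≤-trans (≤-reflexive (size₂ p q r)) (≤-pred size))
    n₃≤n₁ (≤-pred n₃<n₂) (s≤s z≤n))))
  (≤-reflexive (total₃ p q r)) n₃≤n₁))
  where
  N₁ = suc (suc p)
  N₂ = suc (suc q)
  N₃ = suc (suc r)
  size₃ : ∀ p q r → suc (suc p) + suc (suc q) + suc r ≡ suc p + suc (suc q) + suc (suc r)
  size₃ = solve-∀
  size₂ : ∀ p q r → suc (suc p) + suc q + suc (suc r) ≡ suc p + suc (suc q) + suc (suc r)
  size₂ = solve-∀
  total₁ : ∀ p q r → suc (suc (suc p) * suc (suc q) + suc r + 1) ≡ suc (suc p) * suc (suc q) + suc (suc r) + 1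
  total₁ = solve-∀
  total₂ : ∀ p q r → suc (suc q) + (suc p * suc (suc q) + suc (suc r) + 1) ≡ suc (suc p) * suc (suc q) + suc (suc r) + 1
  total₂ = solve-∀
  total₃ : ∀ p q r → suc (suc p) + (suc (suc p) * suc q + suc (suc r) + 1) ≡ suc (suc p) * suc (suc q) + suc (suc r) + 1
  total₃ = solve-∀
... | inj₁ n₃<n₁ | inj₂ refl = bound-largest-part
  (upper-bound fuel (suc p) N₂ N₂ (≤-pred size) (≤-pred n₃<n₁) ≤-refl (s≤s z≤n))
  (≤-reflexive (total₁ p q))
  (bound₂₃ (upper-bound fuel (suc (suc p)) N₂ (suc q) (≤-trans (≤-reflexive (size₃ p q)) (≤-pred size))
    (≤-trans (n≤1+n _) n₃≤n₁) (n≤1+n _) (s≤s z≤n)))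
  (≤-reflexive (total₂ p q))
  where
  N₂ = suc (suc q)
  size₃ : ∀ p q → suc (suc p) + suc (suc q) + suc q ≡ suc p + suc (suc q) + suc (suc q)
  size₃ = solve-∀
  total₁ : ∀ p q → suc (suc q) + (suc p * suc (suc q) + suc (suc q) + 1) ≡ suc (suc p) * suc (suc q) + suc (suc q) + 1
  total₁ = solve-∀
  total₂ : ∀ p q → suc (suc (suc p) * suc (suc q) + suc q + 1) ≡ suc (suc p) * suc (suc q) + suc (suc q) + 1
  total₂ = solve-∀
... | inj₂ refl | inj₁ n₃<n₂ = bound₁₂ (bound-largest-part
  (bound₁₂ (upper-bound fuel N₁ (suc q) N₁ (≤-trans (≤-reflexive (size₂ p q)) (≤-pred size))
    ≤-refl (≤-pred n₃<n₂) (s≤s z≤n)))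
  (≤-reflexive (total₁ p q))
  (bound₂₃ (bound₁₂ (upper-bound fuel N₁ (suc (suc q)) (suc p) (≤-trans (≤-reflexive (size₃ p q)) (≤-pred size))
    (n≤1+n _) (≤-trans (n≤1+n _) n₃≤n₂) (s≤s z≤n))))
  (≤-reflexive (total₂ p q)))
  where
  N₁ = suc (suc p)
  size₂ : ∀ p q → suc (suc p) + suc q + suc (suc p) ≡ suc p + suc (suc q) + suc (suc p)
  size₂ = solve-∀
  size₃ : ∀ p q → suc (suc p) + suc (suc q) + suc p ≡ suc p + suc (suc q) + suc (suc p)
  size₃ = solve-∀
  total₁ : ∀ p q → suc (suc p) + (suc (suc p) * suc q + suc (suc p) + 1) ≡ suc (suc p) * suc (suc q) + suc (suc p) + 1
  total₁ = solve-∀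
  total₂ : ∀ p q → suc (suc (suc p) * suc (suc q) + suc p + 1) ≡ suc (suc p) * suc (suc q) + suc (suc p) + 1
  total₂ = solve-∀
... | inj₂ refl | inj₂ refl = bound-≡ (total₁ r) (balanced
  (bound₁₂ (bound₂₃ (upper-bound fuel s s (suc r) (≤-trans (≤-reflexive (size₃ r)) (≤-pred size))
    (n≤1+n _) (n≤1+n _) (s≤s z≤n))))
  (bound₂₃ (bound₁₂ (upper-bound fuel s (suc r) (suc r) (≤-trans (≤-trans (n≤1+n _) (≤-reflexive (size₂ r))) (≤-pred size))
    (n≤1+n _) ≤-refl (s≤s z≤n))))
  (≤-reflexive (total₂ r)))
  where
  open Balanced
  s = suc (suc r)
  size₃ : ∀ r → suc (suc r) + suc (suc r) + suc r ≡ suc r + suc (suc r) + suc (suc r)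
  size₃ = solve-∀
  size₂ : ∀ r → suc (suc (suc r) + suc r + suc r) ≡ suc r + suc (suc r) + suc (suc r)
  size₂ = solve-∀
  total₁ : ∀ r → suc (suc (suc r) * suc (suc r) + suc r + 1) ≡ suc (suc r) * suc (suc r) + suc (suc r) + 1
  total₁ = solve-∀
  total₂ : ∀ r → suc (suc (suc r)) + (suc (suc r) * suc r + suc r + 1) ≡ suc (suc (suc r) * suc (suc r) + suc r + 1)
  total₂ = solve-∀

-- From graph colourings to colour lists

full⇒length≥ : (L : List (Fin n)) → (∀ x → x ∈ L) → n ≤ length L
full⇒length≥ L full = injective⇒≤ λ {x} {y} eq →
  trans (lookup-index (full x)) (trans (cong (lookup L) eq) (sym (lookup-index (full y))))

opposite-cycle : (C : Colouring n₁ n₂ n₃ K) → NoRainbowMultiC4 C → ∀ {a b c d p q r s} →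
  (a ≢ c → MultiC4 a b c d) → col C a b ≡ p → col C b c ≡ q → col C d a ≡ r → col C c d ≡ s →
  NonRainbow p q r s
opposite-cycle C no-rainbow {a} {b} {c} {d} cycle refl refl refl refl p≢q p≢r p≢s q≢r q≢s r≢s =
  -- If `a` and `c` coincided, symmetry would give `p ≡ q`. `r` and `s` trade places because
  -- `Rainbow` runs around the cycle.
  no-rainbow a b c d (cycle λ { refl → p≢q (symm C a b) }) (p≢q , p≢s , p≢r , q≢s , q≢r , r≢s ∘ sym)

four-cycle : {a b c d : Vertex n₁ n₂ n₃} → Adj a b → Adj b c → Adj c d → Adj d a → Adj b d →
  (∀ i → (part a ≡ i) ⊎ (part b ≡ i) ⊎ (part c ≡ i) ⊎ (part d ≡ i)) → a ≢ c → MultiC4 a b c d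
four-cycle ab bc cd da bd parts a≢c = record
  { a≢b = ab ∘ cong part ; a≢c = a≢c ; a≢d = da ∘ cong part ∘ sym
  ; b≢c = bc ∘ cong part ; b≢d = bd ∘ cong part ; c≢d = cd ∘ cong part
  ; ab = ab ; bc = bc ; cd = cd ; da = da ; allParts = parts }

pattern v₁ i = inj₁ i
pattern v₂ j = inj₂ (inj₁ j)
pattern v₃ k = inj₂ (inj₂ k)

tri : (C : Colouring n₁ n₂ n₃ K) → NoRainbowMultiC4 C → Tri K n₁ n₂ n₃
tri C no-rainbow = record
  { e₁₂ = λ i j → col C (v₁ i) (v₂ j)
  ; e₁₃ = λ i k → col C (v₁ i) (v₃ k)
  ; e₂₃ = λ j k → col C (v₂ j) (v₃ k)
  ; cycle₁ = λ i i′ j k → opposite-cycle C no-rainbow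
      (four-cycle {a = v₁ i} {v₂ j} {v₁ i′} {v₃ k} (λ ()) (λ ()) (λ ()) (λ ()) (λ ())
        λ { zero → inj₁ refl ; (suc zero) → inj₂ (inj₁ refl) ; (suc (suc zero)) → inj₂ (inj₂ (inj₂ refl)) })
      refl (symm C _ _) (symm C _ _) refl
  ; cycle₂ = λ j j′ i k → opposite-cycle C no-rainbow
      (four-cycle {a = v₂ j} {v₁ i} {v₂ j′} {v₃ k} (λ ()) (λ ()) (λ ()) (λ ()) (λ ())
        λ { zero → inj₂ (inj₁ refl) ; (suc zero) → inj₁ refl ; (suc (suc zero)) → inj₂ (inj₂ (inj₂ refl)) })
      (symm C _ _) refl (symm C _ _) refl
  ; cycle₃ = λ k k′ i j → opposite-cycle C no-rainbow
      (four-cycle {a = v₃ k} {v₁ i} {v₃ k′} {v₂ j} (λ ()) (λ ()) (λ ()) (λ ()) (λ ())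
        λ { zero → inj₂ (inj₁ refl) ; (suc zero) → inj₂ (inj₂ (inj₂ refl)) ; (suc (suc zero)) → inj₁ refl })
      (symm C _ _) refl refl (symm C _ _) }

cover⇒≤ : (C : Colouring n₁ n₂ n₃ K) (no-rainbow : NoRainbowMultiC4 C) → Cover (tri C no-rainbow) m → K ≤ m
cover⇒≤ {K = K} C no-rainbow (L , len , cov) = ≤-trans (full⇒length≥ L full) len
  where
  edge : ∀ u v → Adj u v → col C u v ∈ L
  edge (v₁ _) (v₁ _) uv = contradiction refl uv
  edge (v₁ _) (v₂ _) _ = ∈₁₂ cov tt tt
  edge (v₁ _) (v₃ _) _ = ∈₁₃ cov tt tt
  edge (v₂ j) (v₁ i) _ = subst (_∈ L) (symm C (v₁ i) (v₂ j)) (∈₁₂ cov tt tt)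
  edge (v₂ _) (v₂ _) uv = contradiction refl uv
  edge (v₂ _) (v₃ _) _ = ∈₂₃ cov tt tt
  edge (v₃ k) (v₁ i) _ = subst (_∈ L) (symm C (v₁ i) (v₃ k)) (∈₁₃ cov tt tt)
  edge (v₃ k) (v₂ j) _ = subst (_∈ L) (symm C (v₂ j) (v₃ k)) (∈₂₃ cov tt tt)
  edge (v₃ _) (v₃ _) uv = contradiction refl uv
  full : ∀ x → x ∈ L
  full x with onto C x
  ... | u , v , uv , refl = edge u v uv

-- The extremal colouring

module Extremal (n₁ n₂ n₃ : ℕ) where

  colour₁₂ : Fin n₁ → Fin n₂ → Fin (n₁ * n₂ + n₃ + 1)
  colour₁₂ i j = combine i j ↑ˡ n₃ ↑ˡ 1

  colour₁₃ : Fin n₃ → Fin (n₁ * n₂ + n₃ + 1)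
  colour₁₃ k = ((n₁ * n₂) ↑ʳ k) ↑ˡ 1

  colour₂₃ : Fin (n₁ * n₂ + n₃ + 1)
  colour₂₃ = (n₁ * n₂ + n₃) ↑ʳ zero

  colour : Vertex n₁ n₂ n₃ → Vertex n₁ n₂ n₃ → Fin (n₁ * n₂ + n₃ + 1)
  colour (v₁ i) (v₂ j) = colour₁₂ i j
  colour (v₂ j) (v₁ i) = colour₁₂ i j
  colour (v₁ _) (v₃ k) = colour₁₃ k
  colour (v₃ k) (v₁ _) = colour₁₃ k
  -- Besides the edges between parts 2 and 3, this is the default on non-edges.
  colour _      _      = colour₂₃

  colour-sym : ∀ u v → colour u v ≡ colour v u
  colour-sym (v₁ _) (v₁ _) = refl
  colour-sym (v₁ _) (v₂ _) = refl
  colour-sym (v₁ _) (v₃ _) = refl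
  colour-sym (v₂ _) (v₁ _) = refl
  colour-sym (v₂ _) (v₂ _) = refl
  colour-sym (v₂ _) (v₃ _) = refl
  colour-sym (v₃ _) (v₁ _) = refl
  colour-sym (v₃ _) (v₂ _) = refl
  colour-sym (v₃ _) (v₃ _) = refl

  Used : Fin (n₁ * n₂ + n₃ + 1) → Set
  Used x = Σ (Vertex n₁ n₂ n₃) λ u → Σ (Vertex n₁ n₂ n₃) λ v → Adj u v × colour u v ≡ x

  colour-onto : Fin n₁ → Fin n₂ → Fin n₃ → ∀ x → Used x
  colour-onto i₀ j₀ k₀ x = subst Used (join-splitAt (n₁ * n₂ + n₃) 1 x) (used (splitAt (n₁ * n₂ + n₃) x))
    where
    used′ : ∀ s → Used (join (n₁ * n₂) n₃ s ↑ˡ 1)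
    used′ (inj₁ y) = v₁ (proj₁ (remQuot {n₁} n₂ y)) , v₂ (proj₂ (remQuot {n₁} n₂ y)) , (λ ()) ,
      cong (λ z → z ↑ˡ n₃ ↑ˡ 1) (combine-remQuot {n₁} n₂ y)
    used′ (inj₂ k) = v₁ i₀ , v₃ k , (λ ()) , refl
    used : ∀ s → Used (join (n₁ * n₂ + n₃) 1 s)
    used (inj₁ y) = subst (λ z → Used (z ↑ˡ 1)) (join-splitAt (n₁ * n₂) n₃ y) (used′ (splitAt (n₁ * n₂) y))
    used (inj₂ zero) = v₂ j₀ , v₃ k₀ , (λ ()) , refl

  -- If `b` and `d` lie in one part, the two edges at `a` share a colour. Otherwise `c` must lie in
  -- part 3 as well, and the two edges to part 2 both have `colour₂₃`.
  meets-part₃ : ∀ a b c d → part a ≡ suc (suc zero) → Adj a b → Adj b c → Adj c d → Adj d a →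
    NonRainbow (colour a b) (colour b c) (colour c d) (colour d a)
  meets-part₃ (v₃ _) (v₁ _) _ (v₁ _) _ _ _ _ _ _ _ p≢s _ _ _ = p≢s refl
  meets-part₃ (v₃ _) (v₂ _) _ (v₂ _) _ _ _ _ _ _ _ p≢s _ _ _ = p≢s refl
  meets-part₃ (v₃ _) (v₁ _) (v₁ _) (v₂ _) _ _ bc _ _ = contradiction refl bc
  meets-part₃ (v₃ _) (v₁ _) (v₂ _) (v₂ _) _ _ _ cd _ = contradiction refl cd
  meets-part₃ (v₃ _) (v₁ _) (v₃ _) (v₂ _) _ _ _ _ _ _ _ _ _ _ r≢s = r≢s refl
  meets-part₃ (v₃ _) (v₂ _) (v₁ _) (v₁ _) _ _ _ cd _ = contradiction refl cd
  meets-part₃ (v₃ _) (v₂ _) (v₂ _) (v₁ _) _ _ bc _ _ = contradiction refl bc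
  meets-part₃ (v₃ _) (v₂ _) (v₃ _) (v₁ _) _ _ _ _ _ p≢q _ _ _ _ _ = p≢q refl
  meets-part₃ (v₃ _) (v₃ _) _ _ _ ab _ _ _ = contradiction refl ab
  meets-part₃ (v₃ _) _ _ (v₃ _) _ _ _ _ da = contradiction refl da

  colouring : Fin n₁ → Fin n₂ → Fin n₃ → Colouring n₁ n₂ n₃ (n₁ * n₂ + n₃ + 1)
  colouring i₀ j₀ k₀ = record { col = colour ; symm = colour-sym ; onto = colour-onto i₀ j₀ k₀ }

  no-rainbow : ∀ i₀ j₀ k₀ → NoRainbowMultiC4 (colouring i₀ j₀ k₀)
  no-rainbow _ _ _ a b c d record { ab = ab ; bc = bc ; cd = cd ; da = da ; allParts = allParts }
    (p≢q , p≢r , p≢s , q≢r , q≢s , r≢s) with allParts (suc (suc zero))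
  -- The cycle is rotated to start at a vertex of part 3.
  ... | inj₁ a∈₃ = meets-part₃ a b c d a∈₃ ab bc cd da p≢q p≢r p≢s q≢r q≢s r≢s
  ... | inj₂ (inj₁ b∈₃) = meets-part₃ b c d a b∈₃ bc cd da ab q≢r q≢s (p≢q ∘ sym) r≢s (p≢r ∘ sym) (p≢s ∘ sym)
  ... | inj₂ (inj₂ (inj₁ c∈₃)) = meets-part₃ c d a b c∈₃ cd da ab bc
          r≢s (p≢r ∘ sym) (q≢r ∘ sym) (p≢s ∘ sym) (q≢s ∘ sym) p≢q
  ... | inj₂ (inj₂ (inj₂ d∈₃)) = meets-part₃ d a b c d∈₃ da ab bc cd
          (p≢s ∘ sym) (q≢s ∘ sym) (r≢s ∘ sym) p≢q p≢r q≢r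

theorem3 : ∀ (n₁ n₂ n₃ : ℕ) → n₁ ≥ n₂ → n₂ ≥ n₃ → n₃ ≥ 1 →
    IsAntiRamseyC4multi n₁ n₂ n₃ (n₁ * n₂ + n₃ + 1)
theorem3 n₁@(suc _) n₂@(suc _) n₃@(suc _) n₁≥n₂ n₂≥n₃ n₃≥1 =
  (colouring zero zero zero , no-rainbow zero zero zero) ,
  λ k C free → cover⇒≤ C free
    (upper-bound (n₁ + n₂ + n₃) n₁ n₂ n₃ ≤-refl (≤-trans n₂≥n₃ n₁≥n₂) n₂≥n₃ n₃≥1 (tri C free))
  where open Extremal n₁ n₂ n₃
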